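{- (1) If $p$ is a prime with $p\equiv1\pmod6$, then $P_p(3)$ divides $p-1$. (2) If $p$ is a prime with $p\equiv5\pmod6$, then $P_p(3)$ divides $3(p-1)$.
   Context: The Ducci function $D:\mathbb{Z}_p^3\to\mathbb{Z}_p^3$ is $D(x_1,x_2,x_3)=(x_1+x_2,\,x_2+x_3,\,x_3+x_1)$, entries mod $p$. The period $\mathrm{Per}(\mathbf{u})$ is the smallest $k\ge1$ such that $D^{l+k}(\mathbf{u})=D^l(\mathbf{u})$ for some $l\ge0$, and $P_p(3)=\mathrm{Per}(0,0,1)$. -}

module Defs where

open import Data.Nat using (ℕ; zero; suc; _+_; _*_; _∸_; _≤_; z≤n; s≤s; NonZero)
open import Data.Nat.Properties using (+-assoc; +-comm; +-suc; m+[n∸m]≡n; m∸n+n≡m; m≤m*n; m≤m+n; ≤-trans; ≤-refl)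
open import Data.Nat.DivMod using (_mod_)
open import Data.Nat.GeneralisedArithmetic using (fold; fold-+)
open import Data.Fin using (Fin; toℕ; combine)
open import Data.Fin.Properties using (pigeonhole; combine-injective) renaming (_≟_ to _≟ᶠ_)
open import Data.Product using (∃-syntax; _×_; _,_; proj₁; proj₂)
open import Data.Product.Properties using (≡-dec)
open import Relation.Nullary using (Dec; yes; no; contradiction)
open import Relation.Binary.Definitions using (DecidableEquality)
open import Relation.Binary.PropositionalEquality using (_≡_; refl; sym; trans; cong; subst; module ≡-Reasoning)

ℤₘ : ℕ → Set
ℤₘ m = Fin m

infixl 6 _⊕_
_⊕_ : ∀ {m} .{{_ : NonZero m}} → ℤₘ m → ℤₘ m → ℤₘ m
_⊕_ {m} a b = (toℕ a + toℕ b) mod m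

ℤₘ³ : ℕ → Set
ℤₘ³ m = ℤₘ m × ℤₘ m × ℤₘ m

D : ∀ {m} .{{_ : NonZero m}} → ℤₘ³ m → ℤₘ³ m
D (x₁ , x₂ , x₃) = (x₁ ⊕ x₂ , x₂ ⊕ x₃ , x₃ ⊕ x₁)

D^ : ∀ {m} .{{_ : NonZero m}} → ℕ → ℤₘ³ m → ℤₘ³ m
D^ n u = fold u D n

EventuallyRepeats : ∀ {m} .{{_ : NonZero m}} → ℤₘ³ m → ℕ → Set
EventuallyRepeats u k = ∃[ l ] D^ (l + k) u ≡ D^ l u

IsPeriod : ∀ {m} .{{_ : NonZero m}} → ℤₘ³ m → ℕ → Set
IsPeriod u k = 1 ≤ k × EventuallyRepeats u k × (∀ j → 1 ≤ j → EventuallyRepeats u j → k ≤ j)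

private
  least : {Q : ℕ → Set} → (∀ n → Dec (Q n)) → ∀ n → Q n →
          ∃[ k ] Q k × (∀ j → Q j → k ≤ j)
  least Q? zero q = zero , q , λ _ _ → z≤n
  least {Q} Q? (suc n) q with Q? zero
  ... | yes q₀ = zero , q₀ , λ _ _ → z≤n
  ... | no ¬q₀ with least (λ i → Q? (suc i)) n q
  ...   | k , qk , min = suc k , qk , λ
          { zero q₀ → contradiction q₀ ¬q₀
          ; (suc j) qj → s≤s (min j qj) }

  encode : ∀ {m} → ℤₘ³ m → Fin (m * (m * m))
  encode (x₁ , x₂ , x₃) = combine x₁ (combine x₂ x₃)

  encode-injective : ∀ {m} (u v : ℤₘ³ m) → encode u ≡ encode v → u ≡ v
  encode-injective (x₁ , x₂ , x₃) (y₁ , y₂ , y₃) eq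
    with combine-injective x₁ (combine x₂ x₃) y₁ (combine y₂ y₃) eq
  ... | refl , eq′ with combine-injective x₂ x₃ y₂ y₃ eq′
  ...   | refl , refl = refl

  _≟³_ : ∀ {m} → DecidableEquality (ℤₘ³ m)
  _≟³_ = ≡-dec _≟ᶠ_ (≡-dec _≟ᶠ_ _≟ᶠ_)

  module _ {m} .{{_ : NonZero m}} (u : ℤₘ³ m) where

    D^-+ : ∀ a b → D^ (a + b) u ≡ D^ a (D^ b u)
    D^-+ a b = fold-+ u D a

    recurrence : ∃[ i ] ∃[ c ] D^ (i + suc c) u ≡ D^ i u
    recurrence with pigeonhole (≤-refl {suc (m * (m * m))}) (λ i → encode (D^ (toℕ i) u))
    ... | i , j , i<j , eq = toℕ i , toℕ j ∸ suc (toℕ i) ,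
          trans (cong (λ n → D^ n u) (trans (+-suc (toℕ i) _) (m+[n∸m]≡n i<j)))
                (sym (encode-injective _ _ eq))

    shift : ∀ t l k → D^ (l + k) u ≡ D^ l u → D^ (t + l + k) u ≡ D^ (t + l) u
    shift t l k eq = begin
      D^ (t + l + k) u    ≡⟨ cong (λ n → D^ n u) (+-assoc t l k) ⟩
      D^ (t + (l + k)) u  ≡⟨ D^-+ t (l + k) ⟩
      D^ t (D^ (l + k) u) ≡⟨ cong (D^ t) eq ⟩
      D^ t (D^ l u)       ≡⟨ D^-+ t l ⟨
      D^ (t + l) u        ∎
      where open ≡-Reasoning

    -- Any eventual repetition is already visible at an index i that recurs.
    pull-back : ∀ i c → D^ (i + suc c) u ≡ D^ i u →
                ∀ l k → D^ (l + k) u ≡ D^ l u → D^ (i + k) u ≡ D^ i u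
    pull-back i c rec l k eq = begin
      D^ (i + k) u             ≡⟨ cong (λ n → D^ n u) (+-comm i k) ⟩
      D^ (k + i) u             ≡⟨ D^-+ k i ⟩
      D^ k (D^ i u)            ≡⟨ cong (D^ k) (loop l) ⟨
      D^ k (D^ (l * suc c + i) u) ≡⟨ D^-+ k (l * suc c + i) ⟨
      D^ (k + (l * suc c + i)) u  ≡⟨ cong (λ n → D^ n u) (+-comm k (l * suc c + i)) ⟩
      D^ (l * suc c + i + k) u    ≡⟨ subst (λ n → D^ (n + k) u ≡ D^ n u) (m∸n+n≡m l≤) (shift (l * suc c + i ∸ l) l k eq) ⟩
      D^ (l * suc c + i) u        ≡⟨ loop l ⟩
      D^ i u                   ∎
      where
        open ≡-Reasoning
        loop : ∀ n → D^ (n * suc c + i) u ≡ D^ i u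
        loop zero = refl
        loop (suc n) = begin
          D^ (suc c + n * suc c + i) u      ≡⟨ cong (λ a → D^ a u) (+-assoc (suc c) (n * suc c) i) ⟩
          D^ (suc c + (n * suc c + i)) u    ≡⟨ D^-+ (suc c) (n * suc c + i) ⟩
          D^ (suc c) (D^ (n * suc c + i) u) ≡⟨ cong (D^ (suc c)) (loop n) ⟩
          D^ (suc c) (D^ i u)               ≡⟨ D^-+ (suc c) i ⟨
          D^ (suc c + i) u                  ≡⟨ cong (λ a → D^ a u) (+-comm (suc c) i) ⟩
          D^ (i + suc c) u                  ≡⟨ rec ⟩
          D^ i u                            ∎
        l≤ : l ≤ l * suc c + i
        l≤ = ≤-trans (m≤m*n l (suc c)) (m≤m+n (l * suc c) i)

-- The iterates of u lie in a finite set, so the least k ≥ 1 exists.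
period : ∀ {m} .{{_ : NonZero m}} (u : ℤₘ³ m) → ∃[ k ] IsPeriod u k
period u with recurrence u
... | i , c , rec with least (λ k → (D^ (i + suc k) u) ≟³ (D^ i u)) c rec
...   | k , eq , min = suc k , s≤s z≤n , (i , eq) , λ
        { (suc j) _ (l , eq′) → s≤s (min j (pull-back u i c rec l (suc j) eq′)) }

Per : ∀ {m} .{{_ : NonZero m}} → ℤₘ³ m → ℕ
Per u = proj₁ (period u)

Per-isPeriod : ∀ {m} .{{_ : NonZero m}} (u : ℤₘ³ m) → IsPeriod u (Per u)
Per-isPeriod u = proj₂ (period u)

-- P₃ m is the quantity P_m(3).
P₃ : ∀ m .{{_ : NonZero m}} → ℕ
P₃ m = Per (0 mod m , 0 mod m , 1 mod m)

{-# OPTIONS --safe #-}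
module Submission where

-- Write D = 1 + S with S the cyclic shift, S³ = 1.  Since p divides the inner
-- binomial coefficients, Dᵖ = 1 + Sᵖ modulo p.  If p ≡ 1 (mod 3) this is D
-- itself; if p ≡ 2 (mod 3) it is 1 + S² = S² D, so D^(3(p-1)) fixes the image
-- of D because (S²)³ = 1.  In both cases the sequence repeats from index 1
-- on, and every eventual repetition is a multiple of the period.

open import Defs
open import Algebra.Properties.CommutativeSemigroup using (interchange)
open import Data.Fin using (toℕ)
open import Data.Fin.Properties using (toℕ<n; toℕ-fromℕ<; toℕ-injective)
open import Data.Nat using (ℕ; zero; suc; _+_; _*_; _∸_; _<_; _/_; z≤n; s≤s; z<s; NonZero; >-nonZero)
open import Data.Nat.Combinatorics using (_C_; nCn≡1; nC1≡n; nCk≡nC[n∸k]; k>n⇒nCk≡0; nCk+nC[k+1]≡[n+1]C[k+1])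
open import Data.Nat.DivMod using (_%_; _mod_; m%n<n; m≡m%n+[m/n]*n; %-distribˡ-+; %-remove-+ʳ; m<n⇒m%n≡m)
open import Data.Nat.Divisibility using (_∣_; _∣0; ∣m∣n⇒∣m+n; ∣m⇒∣m*n; m∣m*n; m%n≡0⇒n∣m; >⇒∤)
open import Data.Nat.GeneralisedArithmetic using (fold-+)
open import Data.Nat.Primality using (Prime; euclidsLemma)
open import Data.Nat.Properties
open import Data.Nat.Tactic.RingSolver using (solve-∀)
open import Data.Product using (_×_; _,_)
open import Data.Product.Properties using (×-≡,≡→≡)
open import Data.Sum using (inj₁; inj₂)
open import Function using (_∘_)
open import Relation.Nullary using (contradiction)
open import Relation.Binary.PropositionalEquality using (_≡_; refl; sym; trans; cong; cong₂; subst; module ≡-Reasoning)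

open ≡-Reasoning

-- Binomial sums

Σ< : ℕ → (ℕ → ℕ) → ℕ
Σ< zero    g = 0
Σ< (suc n) g = Σ< n g + g n

Σ<-cong : ∀ n {g h : ℕ → ℕ} → (∀ k → g k ≡ h k) → Σ< n g ≡ Σ< n h
Σ<-cong zero    eq = refl
Σ<-cong (suc n) eq = cong₂ _+_ (Σ<-cong n eq) (eq n)

Σ<-head : ∀ n g → Σ< (suc n) g ≡ g 0 + Σ< n (g ∘ suc)
Σ<-head zero    g = +-comm 0 (g 0)
Σ<-head (suc n) g = trans (cong (_+ g (suc n)) (Σ<-head n g)) (+-assoc (g 0) _ _)

Σ<-+ : ∀ n g h → Σ< n (λ k → g k + h k) ≡ Σ< n g + Σ< n h
Σ<-+ zero    g h = refl
Σ<-+ (suc n) g h = trans (cong (_+ (g n + h n)) (Σ<-+ n g h))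
  (interchange +-commutativeSemigroup (Σ< n g) (Σ< n h) (g n) (h n))

∣-Σ< : ∀ {d} n g → (∀ {k} → k < n → d ∣ g k) → d ∣ Σ< n g
∣-Σ< {d} zero g div = d ∣0
∣-Σ< (suc n) g div = ∣m∣n⇒∣m+n (∣-Σ< n g (div ∘ m<n⇒m<1+n)) (div ≤-refl)

nC0≡1 : ∀ n → n C 0 ≡ 1
nC0≡1 n = trans (nCk≡nC[n∸k] {0} {n} z≤n) (nCn≡1 n)

-- The absorption identity, by induction on `n` with Pascal's rule. Its product form needs no
-- division and is what Euclid's lemma takes as input in `prime∣C`.
[1+k]*[1+n]C[1+k]≡[1+n]*nCk : ∀ n k → suc k * (suc n C suc k) ≡ suc n * (n C k)
[1+k]*[1+n]C[1+k]≡[1+n]*nCk n zero = begin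
  1 * (suc n C 1)   ≡⟨ *-identityˡ (suc n C 1) ⟩
  suc n C 1         ≡⟨ nC1≡n (suc n) ⟩
  suc n             ≡⟨ *-identityʳ (suc n) ⟨
  suc n * 1         ≡⟨ cong (suc n *_) (nC0≡1 n) ⟨
  suc n * (n C 0)   ∎
[1+k]*[1+n]C[1+k]≡[1+n]*nCk zero (suc k) = begin
  suc (suc k) * (1 C suc (suc k)) ≡⟨ cong (suc (suc k) *_) (k>n⇒nCk≡0 {1} {suc (suc k)} (s≤s z<s)) ⟩
  suc (suc k) * 0                 ≡⟨ *-zeroʳ (suc (suc k)) ⟩
  1 * 0                           ≡⟨ cong (1 *_) (k>n⇒nCk≡0 {0} {suc k} z<s) ⟨
  1 * (0 C suc k)                 ∎
[1+k]*[1+n]C[1+k]≡[1+n]*nCk (suc n) (suc k) = begin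
  suc (suc k) * (suc (suc n) C suc (suc k))
    ≡⟨ cong (suc (suc k) *_) (nCk+nC[k+1]≡[n+1]C[k+1] (suc n) (suc k)) ⟨
  suc (suc k) * (c + (suc n C suc (suc k)))
    ≡⟨ *-distribˡ-+ (suc (suc k)) c _ ⟩
  c + suc k * c + suc (suc k) * (suc n C suc (suc k))
    -- One copy of `c` has been split off `suc (suc k) * c`. The other two terms fall under the
    -- induction hypotheses at `k` and `suc k`, and Pascal's rule then merges their right sides into
    -- `suc n * c`.
    ≡⟨ cong₂ (λ a b → c + a + b) ([1+k]*[1+n]C[1+k]≡[1+n]*nCk n k) ([1+k]*[1+n]C[1+k]≡[1+n]*nCk n (suc k)) ⟩
  c + suc n * (n C k) + suc n * (n C suc k)
    ≡⟨ +-assoc c _ _ ⟩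
  c + (suc n * (n C k) + suc n * (n C suc k))
    ≡⟨ cong (c +_) (*-distribˡ-+ (suc n) (n C k) (n C suc k)) ⟨
  c + suc n * ((n C k) + (n C suc k))
    ≡⟨ cong (λ a → c + suc n * a) (nCk+nC[k+1]≡[n+1]C[k+1] n k) ⟩
  suc (suc n) * c ∎
  where c = suc n C suc k

-- By absorption p = `suc n` divides `suc k * (p C suc k)`, and it cannot divide the first factor
-- because `0 < suc k < p`.
prime∣C : ∀ {n k} → Prime (suc n) → k < n → suc n ∣ suc n C suc k
prime∣C {n} {k} pr k<n
  with euclidsLemma (suc k) (suc n C suc k) pr
         (subst (suc n ∣_) (sym ([1+k]*[1+n]C[1+k]≡[1+n]*nCk n k)) (m∣m*n (n C k)))
... | inj₁ p∣1+k = contradiction p∣1+k (>⇒∤ (s≤s k<n))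
... | inj₂ p∣C   = p∣C

-- With the shift S sending `f` to `f ∘ suc`, this is the value at 0 of (1 + S)ⁿ `f`.
binomialSum : ℕ → (ℕ → ℕ) → ℕ
binomialSum n f = Σ< (suc n) (λ k → (n C k) * f k)

-- This is (1 + S)ⁿ⁺¹ = (1 + S)ⁿ + (1 + S)ⁿ S. Pascal's rule applies to the terms of positive index
-- only, so the term of index 0 is split off first.
binomialSum-suc : ∀ n f → binomialSum (suc n) f ≡ binomialSum n f + binomialSum n (f ∘ suc)
binomialSum-suc n f = begin
  binomialSum (suc n) f
    ≡⟨ Σ<-head (suc n) (λ k → (suc n C k) * f k) ⟩
  (suc n C 0) * f 0 + Σ< (suc n) (λ k → (suc n C suc k) * f (suc k))
    ≡⟨ cong₂ (λ a b → a * f 0 + b) (trans (nC0≡1 (suc n)) (sym (nC0≡1 n))) (Σ<-cong (suc n) pascal) ⟩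
  (n C 0) * f 0 + Σ< (suc n) (λ k → (n C suc k) * f (suc k) + (n C k) * f (suc k))
    ≡⟨ cong ((n C 0) * f 0 +_) (Σ<-+ (suc n) (λ k → (n C suc k) * f (suc k)) _) ⟩
  (n C 0) * f 0 + (Σ< (suc n) (λ k → (n C suc k) * f (suc k)) + binomialSum n (f ∘ suc))
    ≡⟨ +-assoc ((n C 0) * f 0) _ _ ⟨
  (n C 0) * f 0 + Σ< (suc n) (λ k → (n C suc k) * f (suc k)) + binomialSum n (f ∘ suc)
    -- With its head restored the first sum reaches index `suc n`, one beyond `binomialSum n f`; the
    -- surplus term has coefficient `n C suc n`, which is 0.
    ≡⟨ cong (_+ binomialSum n (f ∘ suc)) (Σ<-head (suc n) (λ k → (n C k) * f k)) ⟨
  binomialSum n f + (n C suc n) * f (suc n) + binomialSum n (f ∘ suc)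
    ≡⟨ cong (λ a → binomialSum n f + a * f (suc n) + binomialSum n (f ∘ suc)) (k>n⇒nCk≡0 {n} {suc n} ≤-refl) ⟩
  binomialSum n f + 0 + binomialSum n (f ∘ suc)
    ≡⟨ cong (_+ binomialSum n (f ∘ suc)) (+-identityʳ (binomialSum n f)) ⟩
  binomialSum n f + binomialSum n (f ∘ suc) ∎
  where
  pascal : ∀ k → (suc n C suc k) * f (suc k) ≡ (n C suc k) * f (suc k) + (n C k) * f (suc k)
  pascal k = begin
    (suc n C suc k) * f (suc k)             ≡⟨ cong (_* f (suc k)) (nCk+nC[k+1]≡[n+1]C[k+1] n k) ⟨
    ((n C k) + (n C suc k)) * f (suc k)     ≡⟨ cong (_* f (suc k)) (+-comm (n C k) (n C suc k)) ⟩
    ((n C suc k) + (n C k)) * f (suc k)     ≡⟨ *-distribʳ-+ (f (suc k)) (n C suc k) (n C k) ⟩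
    (n C suc k) * f (suc k) + (n C k) * f (suc k) ∎

-- Only the two end terms survive modulo p, since p divides every coefficient in `inner`.
binomialSum-prime : ∀ n f → Prime (suc n) → binomialSum (suc n) f % suc n ≡ (f 0 + f (suc n)) % suc n
binomialSum-prime n f pr = begin
  binomialSum p f % p
    ≡⟨ cong (λ a → (a + (p C p) * f p) % p) (Σ<-head n (λ k → (p C k) * f k)) ⟩
  ((p C 0) * f 0 + inner + (p C p) * f p) % p
    ≡⟨ cong₂ (λ a b → (a * f 0 + inner + b * f p) % p) (nC0≡1 p) (nCn≡1 p) ⟩
  (1 * f 0 + inner + 1 * f p) % p
    ≡⟨ cong (_% p) (rearrange (f 0) inner (f p)) ⟩
  (f 0 + f p + inner) % p
    ≡⟨ %-remove-+ʳ (f 0 + f p) (∣-Σ< n _ λ k<n → ∣m⇒∣m*n _ (prime∣C pr k<n)) ⟩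
  (f 0 + f p) % p ∎
  where
  p = suc n
  inner = Σ< n (λ k → (p C suc k) * f (suc k))
  rearrange : ∀ a b c → 1 * a + b + 1 * c ≡ a + c + b
  rearrange = solve-∀

-- The p-th iterate of D

-- The coordinates of a triple, continued 3-periodically, so that S is i ↦ i + 1.
coord : ∀ {m} → ℤₘ³ m → ℕ → ℤₘ m
coord (x , y , z) 0 = x
coord (x , y , z) 1 = y
coord (x , y , z) 2 = z
coord u (suc (suc (suc i))) = coord u i

-- The period is taken as 6, twice the true 3, to match the hypotheses on p modulo 6.
coord-periodic : ∀ {m} (u : ℤₘ³ m) q i → coord u (q * 6 + i) ≡ coord u i
coord-periodic u zero    i = refl
coord-periodic u (suc q) i = coord-periodic u q i

coord-injective : ∀ {m} (u v : ℤₘ³ m) → (∀ i → coord u i ≡ coord v i) → u ≡ v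
coord-injective u v eq = ×-≡,≡→≡ (eq 0 , ×-≡,≡→≡ (eq 1 , eq 2))

module _ {m} .{{_ : NonZero m}} where

  coord-D : ∀ (u : ℤₘ³ m) i → coord (D u) i ≡ coord u i ⊕ coord u (suc i)
  coord-D u 0 = refl
  coord-D u 1 = refl
  coord-D u 2 = refl
  coord-D u (suc (suc (suc i))) = coord-D u i

  toℕ-⊕ : ∀ (a b : ℤₘ m) → toℕ (a ⊕ b) ≡ (toℕ a + toℕ b) % m
  toℕ-⊕ a b = toℕ-fromℕ< (m%n<n (toℕ a + toℕ b) m)

  ⊕-comm : ∀ (a b : ℤₘ m) → a ⊕ b ≡ b ⊕ a
  ⊕-comm a b = toℕ-injective (begin
    toℕ (a ⊕ b)         ≡⟨ toℕ-⊕ a b ⟩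
    (toℕ a + toℕ b) % m ≡⟨ cong (_% m) (+-comm (toℕ a) (toℕ b)) ⟩
    (toℕ b + toℕ a) % m ≡⟨ toℕ-⊕ b a ⟨
    toℕ (b ⊕ a)         ∎)

  -- The expansion of (1 + S)ⁿ, with the sum formed in ℕ and reduced once, so that divisibility of
  -- the coefficients can be used. The index `i` stays general because the induction step needs both
  -- `i` and `suc i`.
  toℕ-coord-D^ : ∀ n (u : ℤₘ³ m) i →
    toℕ (coord (D^ n u) i) ≡ binomialSum n (λ k → toℕ (coord u (k + i))) % m
  toℕ-coord-D^ zero u i = sym (trans (cong (_% m) (+-identityʳ _)) (m<n⇒m%n≡m (toℕ<n (coord u i))))
  toℕ-coord-D^ (suc n) u i = begin
    toℕ (coord (D (D^ n u)) i)
      ≡⟨ cong toℕ (coord-D (D^ n u) i) ⟩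
    toℕ (coord (D^ n u) i ⊕ coord (D^ n u) (suc i))
      ≡⟨ toℕ-⊕ (coord (D^ n u) i) (coord (D^ n u) (suc i)) ⟩
    (toℕ (coord (D^ n u) i) + toℕ (coord (D^ n u) (suc i))) % m
      ≡⟨ cong₂ (λ a b → (a + b) % m) (toℕ-coord-D^ n u i) (toℕ-coord-D^ n u (suc i)) ⟩
    (binomialSum n f % m + binomialSum n (λ k → toℕ (coord u (k + suc i))) % m) % m
      ≡⟨ cong (λ a → (binomialSum n f % m + a % m) % m)
           (Σ<-cong (suc n) λ k → cong (λ j → (n C k) * toℕ (coord u j)) (+-suc k i)) ⟩
    (binomialSum n f % m + binomialSum n (f ∘ suc) % m) % m
      ≡⟨ %-distribˡ-+ (binomialSum n f) (binomialSum n (f ∘ suc)) m ⟨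
    (binomialSum n f + binomialSum n (f ∘ suc)) % m
      ≡⟨ cong (_% m) (binomialSum-suc n f) ⟨
    binomialSum (suc n) f % m ∎
    where
    f : ℕ → ℕ
    f k = toℕ (coord u (k + i))

coord-Dᵖ : ∀ n → Prime (suc n) → ∀ (u : ℤₘ³ (suc n)) i →
  coord (D^ (suc n) u) i ≡ coord u i ⊕ coord u (suc n + i)
coord-Dᵖ n pr u i = toℕ-injective (begin
  toℕ (coord (D^ (suc n) u) i)
    ≡⟨ toℕ-coord-D^ (suc n) u i ⟩
  binomialSum (suc n) (λ k → toℕ (coord u (k + i))) % suc n
    ≡⟨ binomialSum-prime n (λ k → toℕ (coord u (k + i))) pr ⟩
  (toℕ (coord u i) + toℕ (coord u (suc n + i))) % suc n
    ≡⟨ toℕ-⊕ (coord u i) (coord u (suc n + i)) ⟨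
  toℕ (coord u i ⊕ coord u (suc n + i)) ∎)

coord-Dᵖ-mod6 : ∀ n → Prime (suc n) → ∀ (u : ℤₘ³ (suc n)) i →
  coord (D^ (suc n) u) i ≡ coord u i ⊕ coord u (suc n % 6 + i)
coord-Dᵖ-mod6 n pr u i = trans (coord-Dᵖ n pr u i) (cong (coord u i ⊕_) (begin
  coord u (suc n + i)               ≡⟨ cong (λ j → coord u (j + i)) (m≡m%n+[m/n]*n (suc n) 6) ⟩
  coord u (r + q * 6 + i)           ≡⟨ cong (coord u) (rearrange r (q * 6) i) ⟩
  coord u (q * 6 + (r + i))         ≡⟨ coord-periodic u q (r + i) ⟩
  coord u (r + i)                   ∎))
  where
  r = suc n % 6
  q = suc n / 6
  rearrange : ∀ a b c → a + b + c ≡ b + (a + c)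
  rearrange = solve-∀

-- S⁻¹ = S²
rot : ∀ {m} → ℤₘ³ m → ℤₘ³ m
rot (x , y , z) = z , x , y

Dᵖ≡D : ∀ n → Prime (suc n) → suc n % 6 ≡ 1 → ∀ (u : ℤₘ³ (suc n)) → D^ (suc n) u ≡ D u
Dᵖ≡D n pr p%6≡1 u = coord-injective _ _ λ i → begin
  coord (D^ (suc n) u) i                  ≡⟨ coord-Dᵖ-mod6 n pr u i ⟩
  coord u i ⊕ coord u (suc n % 6 + i)     ≡⟨ cong (λ r → coord u i ⊕ coord u (r + i)) p%6≡1 ⟩
  coord u i ⊕ coord u (suc i)             ≡⟨ coord-D u i ⟨
  coord (D u) i                           ∎

-- Here Sᵖ = S⁵ = S⁻¹, and 1 + S⁻¹ = S⁻¹ (S + 1) up to the order of the summands in each coordinate.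
Dᵖ≡rot-D : ∀ n → Prime (suc n) → suc n % 6 ≡ 5 → ∀ (u : ℤₘ³ (suc n)) → D^ (suc n) u ≡ rot (D u)
Dᵖ≡rot-D n pr p%6≡5 u@(x , y , z) = begin
  D^ (suc n) u            ≡⟨ coord-injective _ (x ⊕ z , y ⊕ x , z ⊕ y) coords ⟩
  x ⊕ z , y ⊕ x , z ⊕ y   ≡⟨ cong₂ _,_ (⊕-comm x z) (cong₂ _,_ (⊕-comm y x) (⊕-comm z y)) ⟩
  rot (D u)               ∎
  where
  coords : ∀ i → coord (D^ (suc n) u) i ≡ coord (x ⊕ z , y ⊕ x , z ⊕ y) i
  coords i = trans (coord-Dᵖ-mod6 n pr u i) (trans (cong (λ r → coord u i ⊕ coord u (r + i)) p%6≡5) (shift i))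
    where
    shift : ∀ i → coord u i ⊕ coord u (5 + i) ≡ coord (x ⊕ z , y ⊕ x , z ⊕ y) i
    shift 0 = refl
    shift 1 = refl
    shift 2 = refl
    shift (suc (suc (suc i))) = shift i

-- Eventual repetitions are multiples of the period

module _ {m} .{{_ : NonZero m}} where

  D^-+ : ∀ a b (u : ℤₘ³ m) → D^ (a + b) u ≡ D^ a (D^ b u)
  D^-+ a b u = fold-+ u D a

  -- The map `D` treats the three coordinates cyclically, so `D (rot u)` and `rot (D u)` agree by
  -- computation.
  D^-rot : ∀ n (u : ℤₘ³ m) → D^ n (rot u) ≡ rot (D^ n u)
  D^-rot zero    u = refl
  D^-rot (suc n) u = cong D (D^-rot n u)

  repeats-shift : ∀ (u : ℤₘ³ m) t {l k} → D^ (l + k) u ≡ D^ l u → D^ (t + l + k) u ≡ D^ (t + l) u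
  repeats-shift u t {l} {k} eq = begin
    D^ (t + l + k) u    ≡⟨ cong (λ n → D^ n u) (+-assoc t l k) ⟩
    D^ (t + (l + k)) u  ≡⟨ D^-+ t (l + k) u ⟩
    D^ t (D^ (l + k) u) ≡⟨ cong (D^ t) eq ⟩
    D^ t (D^ l u)       ≡⟨ D^-+ t l u ⟨
    D^ (t + l) u        ∎

  repeats-* : ∀ (u : ℤₘ³ m) q {l k} → D^ (l + k) u ≡ D^ l u → D^ (l + q * k) u ≡ D^ l u
  repeats-* u zero {l} eq = cong (λ n → D^ n u) (+-identityʳ l)
  repeats-* u (suc q) {l} {k} eq = begin
    D^ (l + (k + q * k)) u ≡⟨ cong (λ n → D^ n u) (rearrange l k (q * k)) ⟩
    D^ (q * k + l + k) u   ≡⟨ repeats-shift u (q * k) {l} {k} eq ⟩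
    D^ (q * k + l) u       ≡⟨ cong (λ n → D^ n u) (+-comm (q * k) l) ⟩
    D^ (l + q * k) u       ≡⟨ repeats-* u q {l} {k} eq ⟩
    D^ l u                 ∎
    where
    rearrange : ∀ a b c → a + (b + c) ≡ c + a + b
    rearrange = solve-∀

  -- Both repetitions are moved to start at a late enough common index. There `k / a` copies of `a`
  -- can be added to the remainder without changing the iterate, which completes it to `k`, and then
  -- `k` itself can be removed.
  repeats-% : ∀ (u : ℤₘ³ m) {a k} .{{_ : NonZero a}} →
    EventuallyRepeats u a → EventuallyRepeats u k → EventuallyRepeats u (k % a)
  repeats-% u {a} {k} (l , eqₐ) (l′ , eqₖ) = l′ + l , (begin
    D^ (l′ + l + r) u                 ≡⟨ cong (λ n → D^ n u) (cycle l′ l r) ⟩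
    D^ (r + l′ + l) u                 ≡⟨ repeats-* u (k / a) {r + l′ + l} {a} (repeats-shift u (r + l′) {l} {a} eqₐ) ⟨
    D^ (r + l′ + l + k / a * a) u     ≡⟨ cong (λ n → D^ n u) (rearrange r l′ l (k / a * a)) ⟩
    D^ (l + l′ + (r + k / a * a)) u   ≡⟨ cong (λ n → D^ (l + l′ + n) u) (m≡m%n+[m/n]*n k a) ⟨
    D^ (l + l′ + k) u                 ≡⟨ repeats-shift u l {l′} {k} eqₖ ⟩
    D^ (l + l′) u                     ≡⟨ cong (λ n → D^ n u) (+-comm l l′) ⟩
    D^ (l′ + l) u                     ∎)
    where
    r = k % a
    cycle : ∀ a b c → a + b + c ≡ c + a + b
    cycle = solve-∀
    rearrange : ∀ a b c d → a + b + c + d ≡ c + b + (a + d)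
    rearrange = solve-∀

  -- The remainder of `k` modulo `a` is again an eventual repetition and lies below `a`; if it were
  -- positive, it would contradict the minimality of `a`.
  period∣repeats : ∀ (u : ℤₘ³ m) {a k} → IsPeriod u a → EventuallyRepeats u k → a ∣ k
  period∣repeats u {a} {k} (1≤a , rep , min) repₖ = m%n≡0⇒n∣m k a (r≡0 (k % a) (m%n<n k a) (repeats-% u rep repₖ))
    where
    instance
      a≢0 : NonZero a
      a≢0 = >-nonZero 1≤a
    r≡0 : ∀ r → r < a → EventuallyRepeats u r → r ≡ 0
    r≡0 zero    _   _    = refl
    r≡0 (suc r) r<a repᵣ = contradiction (min (suc r) z<s repᵣ) (<⇒≱ r<a)

  repeats-from-1 : ∀ (u : ℤₘ³ m) k → D^ k (D u) ≡ D u → EventuallyRepeats u k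
  repeats-from-1 u k eq = 1 , (begin
    D^ (1 + k) u ≡⟨ cong (λ n → D^ n u) (+-comm 1 k) ⟩
    D^ (k + 1) u ≡⟨ D^-+ k 1 u ⟩
    D^ k (D u)   ≡⟨ eq ⟩
    D u          ∎)

  -- As `rot` commutes with the iterates of `D`, each further application of `D^ n` contributes one
  -- more `rot`, and three of them compose to the identity.
  D^3n-fixes : ∀ n (w : ℤₘ³ m) → D^ n w ≡ rot w → D^ (3 * n) w ≡ w
  D^3n-fixes n w eq = begin
    D^ (n + (n + (n + 0))) w       ≡⟨ D^-+ n (n + (n + 0)) w ⟩
    D^ n (D^ (n + (n + 0)) w)      ≡⟨ cong (D^ n) (D^-+ n (n + 0) w) ⟩
    D^ n (D^ n (D^ (n + 0) w))     ≡⟨ cong (λ j → D^ n (D^ n (D^ j w))) (+-identityʳ n) ⟩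
    D^ n (D^ n (D^ n w))           ≡⟨ cong (λ v → D^ n (D^ n v)) eq ⟩
    D^ n (D^ n (rot w))            ≡⟨ cong (D^ n) step ⟩
    D^ n (rot (rot w))             ≡⟨ D^-rot n (rot w) ⟩
    rot (D^ n (rot w))             ≡⟨ cong rot step ⟩
    w                              ∎
    where
    step : D^ n (rot w) ≡ rot (rot w)
    step = trans (D^-rot n w) (cong rot eq)

  D^n-D : ∀ n (u : ℤₘ³ m) → D^ n (D u) ≡ D^ (suc n) u
  D^n-D n u = trans (sym (D^-+ n 1 u)) (cong (λ j → D^ j u) (+-comm n 1))

-- The identity Dᵖ = D says that Dᵖ⁻¹ fixes `D u`, so p - 1 is a repetition from index 1 on, for any
-- starting triple.
Per∣p-1 : ∀ n → Prime (suc n) → suc n % 6 ≡ 1 → ∀ (u : ℤₘ³ (suc n)) → Per u ∣ n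
Per∣p-1 n pr p%6≡1 u = period∣repeats u (Per-isPeriod u)
  (repeats-from-1 u n (trans (D^n-D n u) (Dᵖ≡D n pr p%6≡1 u)))

-- Now Dᵖ⁻¹ acts on `D u` as `rot`, which has order dividing 3; this is the source of the factor 3.
Per∣3[p-1] : ∀ n → Prime (suc n) → suc n % 6 ≡ 5 → ∀ (u : ℤₘ³ (suc n)) → Per u ∣ 3 * n
Per∣3[p-1] n pr p%6≡5 u = period∣repeats u (Per-isPeriod u)
  (repeats-from-1 u (3 * n) (D^3n-fixes n (D u) (trans (D^n-D n u) (Dᵖ≡rot-D n pr p%6≡5 u))))

theorem4p4 : (∀ (p : ℕ) .{{_ : NonZero p}} → Prime p → p % 6 ≡ 1 → P₃ p ∣ p ∸ 1)
    × (∀ (p : ℕ) .{{_ : NonZero p}} → Prime p → p % 6 ≡ 5 → P₃ p ∣ 3 * (p ∸ 1))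
theorem4p4 =
    (λ { (suc n) pr p%6≡1 → Per∣p-1 n pr p%6≡1 (0 mod suc n , 0 mod suc n , 1 mod suc n) })
  , (λ { (suc n) pr p%6≡5 → Per∣3[p-1] n pr p%6≡5 (0 mod suc n , 0 mod suc n , 1 mod suc n) })
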